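{- Let $G$ be a group. If the set $\{x\in G:x^3=1\}$ is $7$-large in $G$, then $G$ is $2$-Engel, i.e. $[x,y,y]=1$ for all $x,y\in G$.
   Context: $[x,y]=x^{ -1}y^{ -1}xy$ and $[x,y,z]=[[x,y],z]$. A subset $X\subseteq G$ is $k$-large in $G$ if the intersection of any $k$ left translates $g_1X\cap\dots\cap g_kX$ ($g_i\in G$) is non-empty. -}

module Defs where

open import Algebra.Bundles using (Group)
open import Data.Fin.Base using (Fin)
open import Data.Nat.Base using (ℕ)
open import Data.Product.Base using (∃; _×_)
open import Level using (Level)
open import Relation.Unary using (Pred; _∈_; Satisfiable; ⋂)
import Algebra.Definitions.RawMonoid as RawMonoidDefs

module _ {c ℓ : Level} (G : Group c ℓ) where
  open Group G

  infixr 8 _^_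

  -- The library writes iterated multiplication additively, as n × x.
  _^_ : Carrier → ℕ → Carrier
  x ^ n = RawMonoidDefs._×_ rawMonoid n x

  [_,_] : Carrier → Carrier → Carrier
  [ x , y ] = x ⁻¹ ∙ y ⁻¹ ∙ x ∙ y

  [_,_,_] : Carrier → Carrier → Carrier → Carrier
  [ x , y , z ] = [ [ x , y ] , z ]

  LeftTranslate : ∀ {p} → Carrier → Pred Carrier p → Pred Carrier _
  LeftTranslate g X y = ∃ λ x → x ∈ X × y ≈ g ∙ x

  -- The translating elements need not be distinct.
  Large : ∀ {p} → ℕ → Pred Carrier p → Set _
  Large k X = (g : Fin k → Carrier) → Satisfiable (⋂ (Fin k) (λ i → LeftTranslate (g i) X))

  TwoEngel : Set _
  TwoEngel = ∀ x y → [ x , y , y ] ≈ ε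

{-# OPTIONS --safe #-}

-- Write T for the set of x with x³ = 1 and a′ for a⁻¹.  The heart is that, if a, b and ba lie in T
-- and x is such that hx ∈ T for the seven elements h = 1, b, b′, a, b′ab′, bab, ba′, then ba′ ∈ T.
-- With t = xb, v = bxb and w = b′xb′, the elements va, wa, ta′ are conjugate to babx, b′ab′x, ba′x,
-- and replacing repeatedly pqp by q′p′q′ (for pq ∈ T) gives
--   xba′b = ta′tbw′ = at′abw′ = av′babw′ = av′a′b′a′w′ = a′vabxa′w′ = a′vabxwawa = a′vat′awa
--         = a′vta′twa = a′x′a′twa = xaxtwa = xab′a,
-- that is, (ba′)³ = 1.  An arbitrary g has this form: choose a with a, ga, g′a ∈ T and put b = ga.
-- Hence G has exponent 3.
module Submission where

open import Defs
open import Algebra.Bundles using (Group)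
import Algebra.Properties.Group as GroupProperties
open import Data.Bool.Base using (Bool; true; false; not)
import Data.Bool.Properties as Bool
open import Data.Fin.Base using (Fin)
open import Data.Fin.Patterns using (0F; 1F; 2F; 3F; 4F; 5F; 6F)
import Data.Fin.Properties as Fin
open import Data.List.Base using (List; []; _∷_)
open import Data.Nat.Base using (ℕ)
open import Data.Product.Base using (∃; _×_; _,_)
open import Data.Vec.Base as Vec using (Vec)
open import Data.Vec.Functional using (Vector) renaming ([] to []ᶠ; _∷_ to _∷ᶠ_)
import Relation.Binary.Reasoning.Setoid as SetoidReasoning
import Relation.Binary.Reflection as Reflection
open import Relation.Binary.Definitions using (_Respects_)
open import Relation.Binary.PropositionalEquality.Core using (refl)
open import Relation.Nullary.Decidable.Core using (yes; no)
open import Relation.Unary using (Pred; _∈_)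

-- Settles identities that hold in every group by comparing reduced words. Relations special to `G`
-- must therefore appear as explicit factors in the identity.
module FreeGroupSolver {c ℓ} (G : Group c ℓ) where
  open Group G renaming (refl to ≈-refl)
  open GroupProperties G
  open SetoidReasoning setoid

  infixl 7 _⊗_
  infix 8 _⁻

  data Expr (n : ℕ) : Set where
    var : Fin n → Expr n
    e   : Expr n
    _⊗_ : Expr n → Expr n → Expr n
    _⁻  : Expr n → Expr n

  ⟦_⟧ : ∀ {n} → Expr n → Vec Carrier n → Carrier
  ⟦ var i ⟧ ρ = Vec.lookup ρ i
  ⟦ e     ⟧ ρ = ε
  ⟦ p ⊗ q ⟧ ρ = ⟦ p ⟧ ρ ∙ ⟦ q ⟧ ρ
  ⟦ p ⁻   ⟧ ρ = ⟦ p ⟧ ρ ⁻¹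

  -- The Boolean is true for a generator and false for its inverse.
  Word : ℕ → Set
  Word n = List (Bool × Fin n)

  signed : Bool → Carrier → Carrier
  signed true  x = x
  signed false x = x ⁻¹

  ⟦_⟧ʷ : ∀ {n} → Word n → Vec Carrier n → Carrier
  ⟦ []          ⟧ʷ ρ = ε
  ⟦ (s , i) ∷ w ⟧ʷ ρ = signed s (Vec.lookup ρ i) ∙ ⟦ w ⟧ʷ ρ

  push : ∀ {n} → Bool → Fin n → Word n → Word n
  push s i []            = (s , i) ∷ []
  push s i ((t , j) ∷ w) with i Fin.≟ j | t Bool.≟ not s
  ... | yes _ | yes _ = w
  ... | _     | _     = (s , i) ∷ (t , j) ∷ w

  -- Normalisation by the left action of the free group on reduced words.
  act : ∀ {n} → Bool → Expr n → Word n → Word n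
  act s     (var i) w = push s i w
  act s     e       w = w
  act true  (p ⊗ q) w = act true p (act true q w)
  act false (p ⊗ q) w = act false q (act false p w)
  act s     (p ⁻)   w = act (not s) p w

  signed-cancel : ∀ s x y → signed s x ∙ (signed (not s) x ∙ y) ≈ y
  signed-cancel true  x y = \\-leftDividesˡ x y
  signed-cancel false x y = \\-leftDividesʳ x y

  signed-not : ∀ s x → signed (not s) x ≈ signed s (x ⁻¹)
  signed-not true  x = ≈-refl
  signed-not false x = sym (⁻¹-involutive x)

  push-correct : ∀ {n} s (i : Fin n) w ρ →
                 ⟦ push s i w ⟧ʷ ρ ≈ signed s (Vec.lookup ρ i) ∙ ⟦ w ⟧ʷ ρ
  push-correct s i []            ρ = ≈-refl
  push-correct s i ((t , j) ∷ w) ρ with i Fin.≟ j | t Bool.≟ not s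
  ... | yes refl | yes refl = sym (signed-cancel s (Vec.lookup ρ i) (⟦ w ⟧ʷ ρ))
  ... | yes _    | no _     = ≈-refl
  ... | no _     | _        = ≈-refl

  -- Both signs go through one induction, because `act` treats `p ⁻` by flipping the sign and never
  -- inverts a word.
  act-correct : ∀ {n} s (p : Expr n) w ρ →
                ⟦ act s p w ⟧ʷ ρ ≈ signed s (⟦ p ⟧ ρ) ∙ ⟦ w ⟧ʷ ρ
  act-correct s     (var i) w ρ = push-correct s i w ρ
  act-correct true  e       w ρ = sym (identityˡ _)
  act-correct false e       w ρ = sym (trans (∙-congʳ ε⁻¹≈ε) (identityˡ _))
  act-correct true  (p ⊗ q) w ρ = begin
    ⟦ act true p (act true q w) ⟧ʷ ρ    ≈⟨ act-correct true p (act true q w) ρ ⟩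
    ⟦ p ⟧ ρ ∙ ⟦ act true q w ⟧ʷ ρ       ≈⟨ ∙-congˡ (act-correct true q w ρ) ⟩
    ⟦ p ⟧ ρ ∙ (⟦ q ⟧ ρ ∙ ⟦ w ⟧ʷ ρ)      ≈⟨ assoc _ _ _ ⟨
    ⟦ p ⟧ ρ ∙ ⟦ q ⟧ ρ ∙ ⟦ w ⟧ʷ ρ        ∎
  act-correct false (p ⊗ q) w ρ = begin
    ⟦ act false q (act false p w) ⟧ʷ ρ        ≈⟨ act-correct false q (act false p w) ρ ⟩
    ⟦ q ⟧ ρ ⁻¹ ∙ ⟦ act false p w ⟧ʷ ρ         ≈⟨ ∙-congˡ (act-correct false p w ρ) ⟩
    ⟦ q ⟧ ρ ⁻¹ ∙ (⟦ p ⟧ ρ ⁻¹ ∙ ⟦ w ⟧ʷ ρ)      ≈⟨ assoc _ _ _ ⟨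
    ⟦ q ⟧ ρ ⁻¹ ∙ ⟦ p ⟧ ρ ⁻¹ ∙ ⟦ w ⟧ʷ ρ        ≈⟨ ∙-congʳ (⁻¹-anti-homo-∙ _ _) ⟨
    (⟦ p ⟧ ρ ∙ ⟦ q ⟧ ρ) ⁻¹ ∙ ⟦ w ⟧ʷ ρ         ∎
  act-correct s     (p ⁻)   w ρ =
    trans (act-correct (not s) p w ρ) (∙-congʳ (signed-not s (⟦ p ⟧ ρ)))

  ⟦_⇓⟧ : ∀ {n} → Expr n → Vec Carrier n → Carrier
  ⟦ p ⇓⟧ ρ = ⟦ act true p [] ⟧ʷ ρ

  correct : ∀ {n} (p : Expr n) ρ → ⟦ p ⇓⟧ ρ ≈ ⟦ p ⟧ ρ
  correct p ρ = trans (act-correct true p [] ρ) (identityʳ _)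

  open Reflection setoid var ⟦_⟧ ⟦_⇓⟧ correct public using (solve; _⊜_)

  infixr 6 _⟨_⟩_

  -- A chain of these ending in `e` is a product of conjugates of relators. Since pqp = (pq)³q′p′q′
  -- in a free group, replacing pqp by q′p′q′ after a prefix u costs exactly one factor u(pq)³u′.
  _⟨_⟩_ : ∀ {n} → Expr n → Expr n → Expr n → Expr n
  p ⟨ r ⟩ q = p ⊗ (r ⊗ (p ⁻ ⊗ q))

  -- Copies the unfolding of `_^_` at 3, trailing unit included, so that its value matches
  -- `CubeTrivial` definitionally.
  cube : ∀ {n} → Expr n → Expr n
  cube p = p ⊗ (p ⊗ (p ⊗ e))

module _ {c ℓ} (G : Group c ℓ) where
  open Group G renaming (refl to ≈-refl)
  open GroupProperties G
  open FreeGroupSolver G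

  CubeTrivial : Pred Carrier ℓ
  CubeTrivial x = _^_ G x 3 ≈ ε

  -- Strips the first link from a chain of `_⟨_⟩_`; repeated use leaves only the final unit.
  drop-conjugate : ∀ {p r q} → r ≈ ε → p ∙ (r ∙ (p ⁻¹ ∙ q)) ≈ q
  drop-conjugate {p} {r} {q} r≈ε =
    trans (∙-congˡ (trans (∙-congʳ r≈ε) (identityˡ _))) (\\-leftDividesˡ p q)

  cube-cong : CubeTrivial Respects _≈_
  cube-cong x≈y = trans (sym (∙-cong x≈y (∙-cong x≈y (∙-congʳ x≈y))))

  cube-inverse : ∀ {x} → CubeTrivial x → CubeTrivial (x ⁻¹)
  cube-inverse {x} x³ = trans (solve 1 (λ x → cube (x ⁻) ⊜ cube x ⁻) ≈-refl x)
                              (trans (⁻¹-cong x³) ε⁻¹≈ε)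

  -- A point x lies in the translate of X by h′ exactly when hx lies in X, so largeness is applied
  -- to the inverses of the `h i`.
  large⇒common : ∀ {p k} {X : Pred Carrier p} → X Respects _≈_ → Large G k X →
                 (h : Vector Carrier k) → ∃ λ x → ∀ i → h i ∙ x ∈ X
  large⇒common resp large h with large (λ i → h i ⁻¹)
  ... | x , x∈ = x , λ i → let (y , y∈X , x≈h⁻¹y) = x∈ i in
    resp (sym (trans (∙-congˡ x≈h⁻¹y) (\\-leftDividesˡ (h i) y))) y∈X

  -- The conjugated cubes are, in order, the replacements in the chain for xba′b above,
  -- with x′ multiplied on the left and a′ba′ on the right.
  cube-quotient : Large G 7 CubeTrivial → ∀ {a b} →
                  CubeTrivial a → CubeTrivial b → CubeTrivial (b ∙ a) → CubeTrivial (b ∙ a ⁻¹)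
  cube-quotient large {a} {b} a³ b³ ba³
    with large⇒common cube-cong large
           (ε ∷ᶠ b ∷ᶠ b ⁻¹ ∷ᶠ a ∷ᶠ b ⁻¹ ∙ a ∙ b ⁻¹ ∷ᶠ b ∙ a ∙ b ∷ᶠ b ∙ a ⁻¹ ∷ᶠ []ᶠ)
  ... | x , hx³ = trans
    (solve 3 (λ a b x → let v = b ⊗ x ⊗ b in
      cube (b ⊗ a ⁻) ⊜
        b ⊗ a ⁻ ⊗ x                              ⟨ cube (b ⁻) ⟩
        e                                        ⟨ cube (b ⊗ a ⁻ ⊗ x) ⟩
        x ⁻ ⊗ a ⊗ v ⁻                            ⟨ cube (b ⊗ a) ⟩
        x ⁻ ⊗ a ⊗ b ⁻                            ⟨ cube ((b ⊗ a ⊗ b ⊗ x) ⁻) ⟩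
        x ⁻                                      ⟨ cube a ⟩
        x ⁻ ⊗ a ⁻ ⊗ v ⊗ a ⊗ b ⊗ x ⊗ a ⁻ ⊗ b      ⟨ cube ((b ⁻ ⊗ a ⊗ b ⁻ ⊗ x) ⁻) ⟩
        x ⁻ ⊗ a ⁻ ⊗ v ⊗ a ⊗ b ⊗ b                ⟨ cube (b ⁻ ⊗ x) ⟩
        x ⁻ ⊗ a ⁻ ⊗ v ⊗ a                        ⟨ cube b ⟩
        x ⁻ ⊗ a ⁻ ⊗ v ⊗ x                        ⟨ cube ((b ⊗ a ⁻ ⊗ x) ⁻) ⟩
        x ⁻ ⊗ a ⁻                                ⟨ cube (b ⊗ x) ⟩
        e                                        ⟨ cube ((a ⊗ x) ⁻) ⟩
        a                                        ⟨ cube (e ⊗ x) ⟩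
        e)
      ≈-refl a b x)
    (trans (drop-conjugate (cube-inverse b³))
    (trans (drop-conjugate (hx³ 6F))
    (trans (drop-conjugate ba³)
    (trans (drop-conjugate (cube-inverse (hx³ 5F)))
    (trans (drop-conjugate a³)
    (trans (drop-conjugate (cube-inverse (hx³ 4F)))
    (trans (drop-conjugate (hx³ 2F))
    (trans (drop-conjugate b³)
    (trans (drop-conjugate (cube-inverse (hx³ 6F)))
    (trans (drop-conjugate (hx³ 1F))
    (trans (drop-conjugate (cube-inverse (hx³ 3F)))
           (drop-conjugate (hx³ 0F)))))))))))))

  exponent-three : Large G 7 CubeTrivial → ∀ g → CubeTrivial g
  exponent-three large g
    with large⇒common cube-cong large
           -- Only three conditions are wanted; the other four slots repeat the first.
           (ε ∷ᶠ g ∷ᶠ g ⁻¹ ∷ᶠ ε ∷ᶠ ε ∷ᶠ ε ∷ᶠ ε ∷ᶠ []ᶠ)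
  ... | a , ha³ = cube-cong (//-rightDividesʳ a g)
    (cube-quotient large a³ (ha³ 1F)
      (trans
        -- Here ba = gaa. Three uses of a³ = 1 turn its cube into (ga′)³, and ga′ is conjugate to
        -- a′g, the inverse of g′a. The form `e ⊗ a` matches the type of `ha³ 0F`.
        (solve 2 (λ g a → cube (g ⊗ a ⊗ a) ⊜
          g                        ⟨ cube (e ⊗ a) ⟩
          g ⊗ a ⁻ ⊗ g              ⟨ cube (e ⊗ a) ⟩
          g ⊗ a ⁻ ⊗ g ⊗ a ⁻ ⊗ g    ⟨ cube (e ⊗ a) ⟩
          g                        ⟨ cube ((g ⁻ ⊗ a) ⁻) ⟩
          e) ≈-refl g a)
        (trans (drop-conjugate (ha³ 0F))
        (trans (drop-conjugate (ha³ 0F))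
        (trans (drop-conjugate (ha³ 0F))
               (drop-conjugate (cube-inverse (ha³ 2F))))))))
    where
    a³ : CubeTrivial a
    a³ = cube-cong (identityˡ a) (ha³ 0F)

  -- y′ commutes with x′yx: x′yxy′ = x′yx′x′y′ = y′xy′x′y′ = y′xxyx = y′x′yx.
  exponent-three⇒2-Engel : (∀ g → CubeTrivial g) → TwoEngel G
  exponent-three⇒2-Engel cubes x y = trans
    (solve 2 (λ x y →
      let [_,_]′ : Expr _ → Expr _ → Expr _
          [ p , q ]′ = p ⁻ ⊗ q ⁻ ⊗ p ⊗ q in
      [ [ x , y ]′ , y ]′ ⊜
        y ⁻ ⊗ x ⁻ ⊗ y          ⟨ cube x ⟩
        y ⁻                    ⟨ cube (x ⁻ ⊗ y) ⟩
        y ⁻ ⊗ y ⁻ ⊗ x          ⟨ cube (y ⁻ ⊗ x ⁻) ⟩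
        y ⁻ ⊗ y ⁻              ⟨ cube x ⟩
        e) ≈-refl x y)
    (trans (drop-conjugate (cubes _))
    (trans (drop-conjugate (cubes _))
    (trans (drop-conjugate (cubes _))
           (drop-conjugate (cubes _)))))

theorem4p3 : ∀ {c ℓ} (G : Group c ℓ) → let open Group G in
    Large G 7 (λ x → _^_ G x 3 ≈ ε) → TwoEngel G
theorem4p3 G large = exponent-three⇒2-Engel G (exponent-three G large)
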